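{- Let $m$ and $n$ be two even positive integers with $m\leq n$, and let $p$ be a positive integer. A magic column rectangle $MCR(m^{(1)},n^{(1)};p)$ exists if and only if both of the following hold: (i) $m+n\equiv 0 \pmod 4$; and (ii) $1=2(2pn+1)^2-(2pm+2pn+1)^2$ or $m\geq (\sqrt{2}-1)n+\frac{\sqrt{2}-1}{2p}$.
   Context: A magic column rectangle $MCR(m^{(1)},n^{(1)};p)$ (with $m\le n$) is an $(m+n)\times p$ matrix whose entries are $1,2,\ldots,(m+n)p$, each appearing exactly once, which is partitioned into two blocks, the first consisting of $m$ rows (an $m\times p$ submatrix) and the second of the remaining $n$ rows (an $n\times p$ submatrix), such that the sum of the entries in every column of each block is the same constant (necessarily $\frac{(m+n)(mp+np+1)}{4}$). -}

module Defs where

open import Algebra.Properties.Semiring.Sum using (sum)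
open import Data.Fin.Base using (Fin; _↑ˡ_; _↑ʳ_)
open import Data.Integer.Base using (+_)
open import Data.Nat.Base as ℕ using (ℕ)
import Data.Nat.Properties as ℕ
open import Data.Product using (∃; ∃!; _×_; _,_; uncurry)
open import Data.Rational.Base
open import Data.Rational.Properties
open import Data.Rational.Solver using (module +-*-Solver)
open import Data.Sum.Base using (_⊎_; inj₁; inj₂)
open import Relation.Binary.Definitions using (tri<; tri≈; tri>)
open import Relation.Binary.PropositionalEquality using (_≡_; refl; sym; trans; cong; subst; subst₂)
open import Relation.Nullary using (¬_; yes; no; contradiction)

Matrix : ℕ → ℕ → Set
Matrix r c = Fin r → Fin c → ℕ

columnSum : ∀ {r c} → Matrix r c → Fin c → ℕ
columnSum A j = sum ℕ.+-*-semiring (λ i → A i j)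

upperBlock : ∀ m n {p} → Matrix (m ℕ.+ n) p → Matrix m p
upperBlock m n A i = A (i ↑ˡ n)

lowerBlock : ∀ m n {p} → Matrix (m ℕ.+ n) p → Matrix n p
lowerBlock m n A i = A (m ↑ʳ i)

record MCR (m n p : ℕ) : Set where
  field
    matrix      : Matrix (m ℕ.+ n) p
    entry≥1     : ∀ i j → 1 ℕ.≤ matrix i j
    entry≤max   : ∀ i j → matrix i j ℕ.≤ (m ℕ.+ n) ℕ.* p
    exactlyOnce : ∀ k → 1 ℕ.≤ k → k ℕ.≤ (m ℕ.+ n) ℕ.* p →
                  ∃! _≡_ λ (ij : Fin (m ℕ.+ n) × Fin p) → uncurry matrix ij ≡ k
    constant    : ℕ
    upperSums   : ∀ j → columnSum (upperBlock m n matrix) j ≡ constant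
    lowerSums   : ∀ j → columnSum (lowerBlock m n matrix) j ≡ constant

-- Real numbers as Dedekind cuts: x is represented by { q ∈ ℚ | q < x },
-- a nonempty proper subset of ℚ that is downward closed and has no
-- greatest element.

record ℝ : Set₁ where
  field
    below     : ℚ → Set
    nonempty  : ∃ below
    proper    : ∃ λ q → ¬ below q
    downward  : ∀ {q r} → q < r → below r → below q
    noMaximum : ∀ {q} → below q → ∃ λ r → q < r × below r

open ℝ

infix 4 _≤ℝ_ _≥ℝ_

_≤ℝ_ : ℝ → ℝ → Set
x ≤ℝ y = ∀ q → below x q → below y q

_≥ℝ_ : ℝ → ℝ → Set
x ≥ℝ y = y ≤ℝ x

fromℚ : ℚ → ℝ
fromℚ c .below q = q < c
fromℚ c .nonempty = c - 1ℚ ,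
  subst (c - 1ℚ <_) (+-identityʳ c) (+-monoʳ-< c (negative⁻¹ (- 1ℚ)))
fromℚ c .proper = c , <-irrefl refl
fromℚ c .downward = <-trans
fromℚ c .noMaximum = <-dense

fromℕ : ℕ → ℝ
fromℕ n = fromℚ (+ n / 1)

private
  below⇒< : ∀ x {q r} → below x q → ¬ below x r → q < r
  below⇒< x {q} {r} q∈x r∉x with <-cmp q r
  ... | tri< q<r _ _    = q<r
  ... | tri≈ _ refl _   = contradiction q∈x r∉x
  ... | tri> _ _ r<q    = contradiction (downward x r<q q∈x) r∉x

infixl 6 _+ℝ_ _-ℚ_
infixl 7 _*ℚ_ _*ℕ_ _/ℕ_

_+ℝ_ : ℝ → ℝ → ℝ
(x +ℝ y) .below q = ∃ λ r → ∃ λ s → below x r × below y s × q ≡ r + s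
(x +ℝ y) .nonempty with nonempty x | nonempty y
... | r , r∈x | s , s∈y = r + s , r , s , r∈x , s∈y , refl
(x +ℝ y) .proper with proper x | proper y
... | a , a∉x | b , b∉y = a + b , λ (r , s , r∈x , s∈y , eq) →
  <-irrefl (sym eq) (+-mono-< (below⇒< x r∈x a∉x) (below⇒< y s∈y b∉y))
(x +ℝ y) .downward {q} q<r+s (r , s , r∈x , s∈y , refl) =
  r , q - r , r∈x , downward y q-r<s s∈y , solve 2 (λ q r → q := r :+ (q :- r)) refl q r
  where
  open +-*-Solver
  q-r<s : q - r < s
  q-r<s = subst (q - r <_) (solve 2 (λ r s → (r :+ s) :- r := s) refl r s) (+-monoˡ-< (- r) q<r+s)
(x +ℝ y) .noMaximum (r , s , r∈x , s∈y , refl) with noMaximum x r∈x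
... | r′ , r<r′ , r′∈x = r′ + s , +-monoˡ-< s r<r′ , r′ , s , r′∈x , s∈y , refl

_-ℚ_ : ℝ → ℚ → ℝ
x -ℚ c = x +ℝ fromℚ (- c)

-- Multiplication by a positive rational: q < x * c iff q / c < x.
_*ℚ_ : ℝ → (c : ℚ) .{{_ : Positive c}} → ℝ
x *ℚ c = record
  { below     = λ q → below x (q * c⁻¹)
  ; nonempty  = let q , q∈x = nonempty x in q * c , subst (below x) (sym (cancel q)) q∈x
  ; proper    = let q , q∉x = proper x in q * c , λ h → q∉x (subst (below x) (cancel q) h)
  ; downward  = λ q<r → downward x (*-monoˡ-<-pos c⁻¹ q<r)
  ; noMaximum = λ {q} h → let r , q/c<r , r∈x = noMaximum x h in
      r * c
    , subst (_< r * c) (cancel′ q) (*-monoˡ-<-pos c q/c<r)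
    , subst (below x) (sym (cancel r)) r∈x
  }
  where
  instance
    c≢0 : NonZero c
    c≢0 = pos⇒nonZero c
  c⁻¹ : ℚ
  c⁻¹ = 1/ c
  instance
    c⁻¹>0 : Positive c⁻¹
    c⁻¹>0 = 1/pos⇒pos c
  cancel : ∀ q → (q * c) * c⁻¹ ≡ q
  cancel q = trans (*-assoc q c c⁻¹) (trans (cong (q *_) (*-inverseʳ c)) (*-identityʳ q))
  cancel′ : ∀ q → (q * c⁻¹) * c ≡ q
  cancel′ q = trans (*-assoc q c⁻¹ c) (trans (cong (q *_) (*-inverseˡ c)) (*-identityʳ q))

_*ℕ_ : ℝ → (n : ℕ) .{{_ : ℕ.NonZero n}} → ℝ
x *ℕ n = (x *ℚ (+ n / 1)) {{normalize-pos n 1}}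

_/ℕ_ : ℝ → (n : ℕ) .{{_ : ℕ.NonZero n}} → ℝ
x /ℕ n = (x *ℚ (+ 1 / n)) {{normalize-pos 1 n}}

private
  2ℚ : ℚ
  2ℚ = + 2 / 1

  Below√2 : ℚ → Set
  Below√2 q = q < 0ℚ ⊎ q * q < 2ℚ

  below√2-downward : ∀ {q r} → q < r → Below√2 r → Below√2 q
  below√2-downward q<r (inj₁ r<0) = inj₁ (<-trans q<r r<0)
  below√2-downward {q} {r} q<r (inj₂ r²<2) with q <? 0ℚ
  ... | yes q<0 = inj₁ q<0
  ... | no  q≮0 = inj₂ (≤-<-trans (≤-trans q²≤qr qr≤r²) r²<2)
    where
    0≤q : 0ℚ ≤ q
    0≤q = ≮⇒≥ q≮0
    q²≤qr : q * q ≤ q * r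
    q²≤qr = *-monoˡ-≤-nonNeg q {{nonNegative 0≤q}} (<⇒≤ q<r)
    qr≤r² : q * r ≤ r * r
    qr≤r² = *-monoʳ-≤-nonNeg r {{nonNegative (≤-trans 0≤q (<⇒≤ q<r))}} (<⇒≤ q<r)

  -- For 0 ≤ q with q² < 2, the rational (2q + 2) / (q + 2) lies strictly
  -- between q and √2.
  below√2-improve : ∀ q → 0ℚ ≤ q → q * q < 2ℚ → ∃ λ r → q < r × Below√2 r
  below√2-improve q 0≤q q²<2 = u * t , q<ut , inj₂ ut²<2
    where
    open +-*-Solver
    d u t : ℚ
    d = 2ℚ + q
    u = 2ℚ + 2ℚ * q
    instance
      d>0 : Positive d
      d>0 = pos+nonNeg⇒pos 2ℚ q {{nonNegative 0≤q}}
      d≢0 : NonZero d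
      d≢0 = pos⇒nonZero d
    t = 1/ d
    instance
      t>0 : Positive t
      t>0 = 1/pos⇒pos d
      t²>0 : Positive (t * t)
      t²>0 = pos*pos⇒pos t t
    qd<u : q * d < u
    qd<u = subst (_< u)
      (solve 1 (λ q → q :* q :+ con 2ℚ :* q := q :* (con 2ℚ :+ q)) refl q)
      (+-monoˡ-< (2ℚ * q) q²<2)
    q<ut : q < u * t
    q<ut = subst (_< u * t)
      (trans (*-assoc q d t) (trans (cong (q *_) (*-inverseʳ d)) (*-identityʳ q)))
      (*-monoˡ-<-pos t qd<u)
    rest : ℚ
    rest = 2ℚ * (q * q) + (2ℚ * 2ℚ * 2ℚ) * q + 2ℚ * 2ℚ
    u²<2d² : u * u < 2ℚ * (d * d)
    u²<2d² = subst₂ _<_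
      (solve 1 (λ q → con 2ℚ :* (q :* q) :+ (con 2ℚ :* (q :* q) :+ (con 2ℚ :* con 2ℚ :* con 2ℚ) :* q :+ con 2ℚ :* con 2ℚ)
                   := (con 2ℚ :+ con 2ℚ :* q) :* (con 2ℚ :+ con 2ℚ :* q)) refl q)
      (solve 1 (λ q → con 2ℚ :* con 2ℚ :+ (con 2ℚ :* (q :* q) :+ (con 2ℚ :* con 2ℚ :* con 2ℚ) :* q :+ con 2ℚ :* con 2ℚ)
                   := con 2ℚ :* ((con 2ℚ :+ q) :* (con 2ℚ :+ q))) refl q)
      (+-monoˡ-< rest (*-monoʳ-<-pos 2ℚ q²<2))
    2d²t²≡2 : 2ℚ * (d * d) * (t * t) ≡ 2ℚ
    2d²t²≡2 = trans
      (solve 2 (λ d t → con 2ℚ :* (d :* d) :* (t :* t) := con 2ℚ :* ((d :* t) :* (d :* t))) refl d t)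
      (cong (λ z → 2ℚ * (z * z)) (*-inverseʳ d))
    ut²<2 : (u * t) * (u * t) < 2ℚ
    ut²<2 = subst₂ _<_
      (solve 2 (λ u t → (u :* u) :* (t :* t) := (u :* t) :* (u :* t)) refl u t)
      2d²t²≡2
      (*-monoˡ-<-pos (t * t) u²<2d²)

  below√2-noMaximum : ∀ {q} → Below√2 q → ∃ λ r → q < r × Below√2 r
  below√2-noMaximum {q} h with q <? 0ℚ | h
  ... | yes q<0 | _ = let r , q<r , r<0 = <-dense q<0 in r , q<r , inj₁ r<0
  ... | no  q≮0 | inj₁ q<0  = contradiction q<0 q≮0
  ... | no  q≮0 | inj₂ q²<2 = below√2-improve q (≮⇒≥ q≮0) q²<2

√2 : ℝ
√2 .below = λ q → q < 0ℚ ⊎ q * q < + 2 / 1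
√2 .nonempty = 0ℚ , inj₂ (positive⁻¹ 2ℚ)
√2 .proper = 2ℚ , λ
  { (inj₁ 2<0) → <-asym 2<0 (positive⁻¹ 2ℚ)
  ; (inj₂ 4<2) → <-asym 4<2 (*-monoʳ-<-pos 2ℚ {1ℚ} {2ℚ} (+-monoʳ-< 1ℚ (positive⁻¹ 1ℚ)))
  }
√2 .downward = below√2-downward
√2 .noMaximum = below√2-noMaximum

{-# OPTIONS --safe #-}

-- Write N = m + n, X = 2pn + 1 and Y = 2pN + 1, and let c be the common column
-- sum.  Summing all entries gives 4c = N(pN + 1), which forces 4 ∣ N since N is
-- even; the np entries of the lower block are distinct positive integers, so
-- n(pn + 1) ≤ 2c.  Together these say 2X² ≤ Y² + 1.  Here equality is the first
-- alternative of (ii), and 2X² ≤ Y² is the second, because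
-- m ≥ (√2 − 1)(n + 1/2p) means Y/X ≥ √2.
--
-- Conversely, cut 1, …, Np into N levels of p consecutive integers.  Each row
-- uses up one level, in increasing or decreasing order, so that two rows of
-- opposite order have constant sum.  Choosing the levels of the upper block
-- fixes its column sums up to a multiple of p.  To lower them by a further
-- r < p, take adjacent levels l in the lower and l + 1 in the upper block, both
-- increasing, and exchange these rows in the last r columns, which changes the
-- sums by p there.  Rotating one more row of each block cyclically by r changes
-- its entries by r − p in these columns and by r in the others (up to sign), so
-- all columns of a block change by the same amount.

module Submission where

open import Defs
open import Algebra.Bundles using (AbelianGroup)
import Algebra.Properties.Group as Group
import Algebra.Properties.Semiring.Sum as SemiringSum
import Data.Fin.Base as Fin
open Fin using (Fin; zero; suc; toℕ; fromℕ<; inject₁; opposite; punchIn; punchOut; cast; combine; remQuot; join; splitAt; _↑ˡ_; _↑ʳ_)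
import Data.Fin.Permutation as Perm
open Perm using (Permutation′; permutation; _⟨$⟩ʳ_; transpose)
open import Data.Fin.Properties using (any?; _≟_; combine-injective; combine-remQuot; fromℕ<-injective; injective⇒≤; join-splitAt; opposite-involutive; opposite-prop; punchIn-injective; punchOut-injective; remQuot-combine; splitAt-join; splitAt-↑ˡ; splitAt-↑ʳ; toℕ-cast; toℕ-combine; toℕ-fromℕ; toℕ-fromℕ<; toℕ-inject₁; toℕ-injective; toℕ-↑ˡ; toℕ-↑ʳ; toℕ<n; ↑ʳ-injective)
import Data.Integer.Base as ℤ
import Data.Integer.Properties as ℤ
import Data.Nat.Base as ℕ
import Data.Nat.Properties as ℕ
open import Data.Product using (∃; ∃!; _×_; _,_; proj₁; proj₂; map₁; uncurry)
import Data.Sum.Base as Sum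
open Sum using (_⊎_; inj₁; inj₂; [_,_]′)
open import Data.Sum.Properties using (inj₁-injective)
open import Function.Base using (_∘_; id)
open import Function.Bundles using (_⇔_; mk⇔; Injection)
open import Function.Definitions using (Injective)
open import Function.Properties.Inverse using (↔⇒↣)
open import Relation.Binary.PropositionalEquality using (_≡_; _≢_; refl; sym; trans; cong; cong₂; subst; subst₂; module ≡-Reasoning)
open import Relation.Nullary using (yes; no; contradiction)
open import Relation.Nullary.Decidable using (dec-false)

-- The real inequality as an integer inequality

module Threshold where

  open import Data.Integer.Base using (+_)
  open import Data.Nat.Base using (ℕ; suc)
  open import Data.Nat.Coprimality as Coprimality using (1-coprimeTo)
  open import Data.Rational.Base
  open import Data.Rational.Properties hiding (_≟_)
  open import Data.Rational.Solver using (module +-*-Solver)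
  open +-*-Solver using (solve; _:+_; _:*_; _:-_; _:=_; con)

  ι : ℕ → ℚ
  ι n = + n / 1

  -- The fraction `+ n / 1` is normalised through a gcd, which is stuck on a variable `n`. Rewriting
  -- to the explicit reduced form lets sums, products and the order compute.
  ι-mkℚ : ∀ n → ι n ≡ mkℚ (+ n) 0 (Coprimality.sym (1-coprimeTo n))
  ι-mkℚ n = normalize-coprime (Coprimality.sym (1-coprimeTo n))

  ι-+ : ∀ a b → ι (a ℕ.+ b) ≡ ι a + ι b
  ι-+ a b rewrite ι-mkℚ a | ι-mkℚ b =
    cong (_/ 1) (sym (cong₂ ℤ._+_ (ℤ.*-identityʳ (+ a)) (ℤ.*-identityʳ (+ b))))

  ι-* : ∀ a b → ι (a ℕ.* b) ≡ ι a * ι b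
  ι-* a b rewrite ι-mkℚ a | ι-mkℚ b = cong (_/ 1) (ℤ.pos-* a b)

  ι-mono-≤ : ∀ {a b} → a ℕ.≤ b → ι a ≤ ι b
  ι-mono-≤ {a} {b} a≤b rewrite ι-mkℚ a | ι-mkℚ b =
    *≤* (subst₂ ℤ._≤_ (sym (ℤ.*-identityʳ (+ a))) (sym (ℤ.*-identityʳ (+ b))) (ℤ.+≤+ a≤b))

  ι-cancel-≤ : ∀ {a b} → ι a ≤ ι b → a ℕ.≤ b
  ι-cancel-≤ {a} {b} le rewrite ι-mkℚ a | ι-mkℚ b =
    ℤ.drop‿+≤+ (subst₂ ℤ._≤_ (ℤ.*-identityʳ (+ a)) (ℤ.*-identityʳ (+ b)) (drop-*≤* le))

  ι*[1/n]≡1 : ∀ n .{{_ : ℕ.NonZero n}} → ι n * (+ 1 / n) ≡ 1ℚ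
  ι*[1/n]≡1 n@(suc n-1) rewrite ι-mkℚ n | normalize-coprime (1-coprimeTo n) =
    *-inverseʳ (mkℚ (+ n) 0 (Coprimality.sym (1-coprimeTo n)))

  *-assoc-cancel : ∀ q {c d} → c * d ≡ 1ℚ → q * c * d ≡ q
  *-assoc-cancel q {c} {d} cd≡1 = trans (*-assoc q c d) (trans (cong (q *_) cd≡1) (*-identityʳ q))

  square-cancel-< : ∀ {q z} → 0ℚ ≤ z → q * q < z * z → q < z
  square-cancel-< {q} {z} 0≤z q²<z² with q <? z
  ... | yes q<z = q<z
  ... | no  q≮z = contradiction (<-≤-trans q²<z² (≤-trans z²≤zq zq≤q²)) (<-irrefl refl)
    where
    z≤q : z ≤ q
    z≤q = ≮⇒≥ q≮z
    z²≤zq : z * z ≤ z * q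
    z²≤zq = *-monoˡ-≤-nonNeg z {{nonNegative 0≤z}} z≤q
    zq≤q² : z * q ≤ q * q
    zq≤q² = *-monoʳ-≤-nonNeg q {{nonNegative (≤-trans 0≤z z≤q)}} z≤q

  module _ (m n p : ℕ) .{{_ : ℕ.NonZero n}} .{{_ : ℕ.NonZero p}} where

    private
      instance
        2p≢0 : ℕ.NonZero (2 ℕ.* p)
        2p≢0 = ℕ.m*n≢0 2 p
      X Y : ℕ
      X = 2 ℕ.* p ℕ.* n ℕ.+ 1
      Y = 2 ℕ.* p ℕ.* m ℕ.+ 2 ℕ.* p ℕ.* n ℕ.+ 1
      P d : ℚ
      P = ι (2 ℕ.* p)
      d = + 1 / (2 ℕ.* p)
      instance
        X≢0 : ℕ.NonZero X
        X≢0 = ℕ.>-nonZero (ℕ.m≤n+m 1 (2 ℕ.* p ℕ.* n))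
        X>0 : Positive (ι X)
        X>0 = normalize-pos X 1
        X²>0 : Positive (ι X * ι X)
        X²>0 = pos*pos⇒pos (ι X) (ι X)
        n>0 : Positive (ι n)
        n>0 = normalize-pos n 1
        d>0 : Positive d
        d>0 = normalize-pos 1 (2 ℕ.* p)
        n≢0 : NonZero (ι n)
        n≢0 = pos⇒nonZero (ι n)
        d≢0 : NonZero d
        d≢0 = pos⇒nonZero d
      -- `z` is Y/X, the rational to be compared with √2; accordingly `u` takes the place of √2 - 1.
      1/X z u : ℚ
      1/X = + 1 / X
      z = ι Y * 1/X
      u = z - 1ℚ

      ιX : ι X ≡ P * ι n + 1ℚ
      ιX = trans (ι-+ (2 ℕ.* p ℕ.* n) 1) (cong (_+ 1ℚ) (ι-* (2 ℕ.* p) n))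

      ιY : ι Y ≡ P * ι m + ι X
      ιY = trans (cong ι (ℕ.+-assoc (2 ℕ.* p ℕ.* m) (2 ℕ.* p ℕ.* n) 1))
                 (trans (ι-+ (2 ℕ.* p ℕ.* m) X) (cong (_+ ι X) (ι-* (2 ℕ.* p) m)))

      zX≡Y : z * ι X ≡ ι Y
      zX≡Y = *-assoc-cancel (ι Y) (trans (*-comm 1/X (ι X)) (ι*[1/n]≡1 X))

      uX≡Pm : u * ι X ≡ P * ι m
      uX≡Pm = begin
        (z - 1ℚ) * ι X            ≡⟨ solve 2 (λ z x → (z :- con 1ℚ) :* x := z :* x :- x) refl z (ι X) ⟩
        z * ι X - ι X             ≡⟨ cong (_- ι X) (trans zX≡Y ιY) ⟩
        P * ι m + ι X - ι X       ≡⟨ solve 2 (λ y x → y :+ x :- x := y) refl (P * ι m) (ι X) ⟩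
        P * ι m                   ∎
        where open ≡-Reasoning

      -- Since X = 2p(n + 1/2p) and uX = 2pm, replacing √2 - 1 by `u` in the threshold gives exactly
      -- m. Comparing m with the threshold is thus comparing `z` with √2.
      un+ud≡m : u * ι n + u * d ≡ ι m
      un+ud≡m = begin
        u * ι n + u * d            ≡⟨ cong (λ t → u * t + u * d) (*-identityʳ (ι n)) ⟨
        u * (ι n * 1ℚ) + u * d     ≡⟨ cong (λ t → u * (ι n * t) + u * d) (ι*[1/n]≡1 (2 ℕ.* p)) ⟨
        u * (ι n * (P * d)) + u * d ≡⟨ solve 4 (λ u n P d → u :* (n :* (P :* d)) :+ u :* d := u :* (P :* n :+ con 1ℚ) :* d) refl u (ι n) P d ⟩
        u * (P * ι n + 1ℚ) * d     ≡⟨ cong (λ t → u * t * d) ιX ⟨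
        u * ι X * d                ≡⟨ cong (_* d) (trans uX≡Pm (*-comm P (ι m))) ⟩
        ι m * P * d                ≡⟨ *-assoc-cancel (ι m) (ι*[1/n]≡1 (2 ℕ.* p)) ⟩
        ι m                        ∎
        where open ≡-Reasoning

      ι-^2 : ∀ a → ι (a ℕ.^ 2) ≡ ι a * ι a
      ι-^2 a = trans (cong (λ t → ι (a ℕ.* t)) (ℕ.*-identityʳ a)) (ι-* a a)

      ι2X² : ι (2 ℕ.* X ℕ.^ 2) ≡ ι 2 * (ι X * ι X)
      ι2X² = trans (ι-* 2 (X ℕ.^ 2)) (cong (ι 2 *_) (ι-^2 X))

      z²X²≡Y² : z * z * (ι X * ι X) ≡ ι (Y ℕ.^ 2)
      z²X²≡Y² = trans (solve 2 (λ z x → z :* z :* (x :* x) := z :* x :* (z :* x)) refl z (ι X))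
                      (trans (cong₂ _*_ zX≡Y zX≡Y) (sym (ι-^2 Y)))

      0≤z : 0ℚ ≤ z
      0≤z = nonNegative⁻¹ z {{nonNeg*nonNeg⇒nonNeg (ι Y) {{normalize-nonNeg Y 1}} 1/X {{normalize-nonNeg 1 X}}}}

    2X²≤Y²⇒m≥threshold : 2 ℕ.* X ℕ.^ 2 ℕ.≤ Y ℕ.^ 2 →
                          fromℕ m ≥ℝ (√2 -ℚ 1ℚ) *ℕ n +ℝ (√2 -ℚ 1ℚ) /ℕ (2 ℕ.* p)
    2X²≤Y²⇒m≥threshold 2X²≤Y² q (r , s , r∈ , s∈ , q≡r+s) =
      subst₂ _<_ (sym q≡r+s) un+ud≡m
        (+-mono-< (clear r (ι n) (<u r∈)) (clear s d (<u s∈)))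
      where
      2≤z² : ι 2 ≤ z * z
      2≤z² = *-cancelʳ-≤-pos (ι X * ι X) (subst₂ _≤_ ι2X² (sym z²X²≡Y²) (ι-mono-≤ 2X²≤Y²))
      √2≤z : ∀ {v} → ℝ.below √2 v → v < z
      √2≤z (inj₁ v<0)  = <-≤-trans v<0 0≤z
      √2≤z (inj₂ v²<2) = square-cancel-< 0≤z (<-≤-trans v²<2 2≤z²)
      <u : ∀ {w} → ℝ.below (√2 -ℚ 1ℚ) w → w < u
      <u (v , w , v∈ , w<-1 , refl) = +-mono-< (√2≤z v∈) w<-1
      -- Membership in a multiple of a cut is defined by dividing by the factor; this undoes the
      -- division.
      clear : ∀ q c .{{_ : Positive c}} .{{_ : NonZero c}} → q * 1/ c < u → q < u * c
      clear q c lt = subst (_< u * c) (*-assoc-cancel q (*-inverseˡ c)) (*-monoˡ-<-pos c lt)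

    -- By contradiction: if z² < 2, then `u` lies below √2 - 1, so m = un + ud lies in the cut of
    -- the threshold and hence strictly below itself.
    m≥threshold⇒2X²≤Y² : fromℕ m ≥ℝ (√2 -ℚ 1ℚ) *ℕ n +ℝ (√2 -ℚ 1ℚ) /ℕ (2 ℕ.* p) →
                          2 ℕ.* X ℕ.^ 2 ℕ.≤ Y ℕ.^ 2
    m≥threshold⇒2X²≤Y² m≥ = ι-cancel-≤
      (subst₂ _≤_ (sym ι2X²) z²X²≡Y² (*-monoʳ-≤-nonNeg (ι X * ι X) {{pos⇒nonNeg (ι X * ι X)}} 2≤z²))
      where
      u∈ : z * z < ι 2 → ℝ.below (√2 -ℚ 1ℚ) u
      -- Splitting `u` as z + (-1) fails, because -1 is not strictly below -1. A rational `v`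
      -- strictly between `z` and √2 leaves the second summand strictly below -1.
      u∈ z²<2 with ℝ.noMaximum √2 {z} (inj₂ z²<2)
      ... | v , z<v , v∈ = v , u - v , v∈ ,
        subst₂ _<_ (solve 2 (λ z v → z :- (v :+ con 1ℚ) := z :- con 1ℚ :- v) refl z v)
                   (solve 1 (λ v → v :- (v :+ con 1ℚ) := con (- 1ℚ)) refl v)
                   (+-monoˡ-< (- (v + 1ℚ)) z<v) ,
        solve 2 (λ u v → u := v :+ (u :- v)) refl u v
      2≤z² : ι 2 ≤ z * z
      2≤z² = ≮⇒≥ λ z²<2 → <-irrefl refl (m≥ (ι m)
        (u * ι n , u * d ,
         subst (ℝ.below (√2 -ℚ 1ℚ)) (sym (*-assoc-cancel u (*-inverseʳ (ι n)))) (u∈ z²<2) ,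
         subst (ℝ.below (√2 -ℚ 1ℚ)) (sym (*-assoc-cancel u (*-inverseʳ d))) (u∈ z²<2) ,
         sym un+ud≡m))

open Threshold using (2X²≤Y²⇒m≥threshold; m≥threshold⇒2X²≤Y²)
open import Data.Nat.Base
open import Data.Nat.Divisibility using (_∣_; divides; ∣m+n∣m⇒∣n; m∣m*n; *-monoˡ-∣; n∣m⇒m%n≡0; m%n≡0⇒n∣m)
open import Data.Nat.DivMod using (DivMod; _divMod_; m<n⇒m%n≡m; [m+kn]%n≡m%n)
open import Data.Nat.Properties hiding (_≟_)
open import Data.Nat.Tactic.RingSolver using (solve-∀)
open import Data.Rational.Base using (1ℚ)
open SemiringSum +-*-semiring

-- Necessity

sum-const : ∀ k c → sum {k} (λ _ → c) ≡ k * c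
sum-const zero    c = refl
sum-const (suc k) c = cong (c +_) (sum-const k c)

sum-++ : ∀ m {n} (f : Fin (m + n) → ℕ) → sum f ≡ sum (f ∘ (_↑ˡ n)) + sum (f ∘ (m ↑ʳ_))
sum-++ zero    f = refl
sum-++ (suc m) f = trans (cong (f zero +_) (sum-++ m (f ∘ suc))) (sym (+-assoc (f zero) _ _))

sum-combine : ∀ r {c} (f : Fin (r * c) → ℕ) → sum f ≡ sum λ i → sum λ j → f (combine {r} {c} i j)
sum-combine zero        f = refl
sum-combine (suc r) {c} f = trans (sum-++ c f) (cong (sum (f ∘ (_↑ˡ r * c)) +_) (sum-combine r (f ∘ (c ↑ʳ_))))

-- Induction removes a value of at least `suc k`. One exists, for otherwise all predecessors of
-- values are below `k`, and `suc k` indices would inject into `Fin k`.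
sum-positive-injective : ∀ {k} (f : Fin k → ℕ) → (∀ i → 1 ≤ f i) → Injective _≡_ _≡_ f →
                         k * suc k ≤ 2 * sum f
sum-positive-injective {zero}  f f≥1 inj = z≤n
sum-positive-injective {suc k} f f≥1 inj with any? (λ i → suc k ≤? f i)
... | yes (i , k<fi) = begin
  suc k * suc (suc k)                     ≡⟨ expand k ⟩
  2 * suc k + k * suc k                   ≤⟨ +-mono-≤ (*-monoʳ-≤ 2 k<fi) (sum-positive-injective (f ∘ punchIn i) (f≥1 ∘ punchIn i) (punchIn-injective i _ _ ∘ inj)) ⟩
  2 * f i + 2 * sum (f ∘ punchIn i)       ≡⟨ *-distribˡ-+ 2 (f i) _ ⟨
  2 * (f i + sum (f ∘ punchIn i))         ≡⟨ cong (2 *_) (sum-remove {i = i} f) ⟨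
  2 * sum f                               ∎
  where
  open ≤-Reasoning
  expand : ∀ k → suc k * suc (suc k) ≡ 2 * suc k + k * suc k
  expand = solve-∀
... | no ¬big = contradiction (injective⇒≤ h-injective) 1+n≰n
  where
  f-1<k : ∀ i → pred (f i) < k
  f-1<k i = ≤-trans (≤-reflexive (suc-pred (f i) {{>-nonZero (f≥1 i)}})) (s≤s⁻¹ (≰⇒> (¬big ∘ (i ,_))))
  h : Fin (suc k) → Fin k
  h i = fromℕ< (f-1<k i)
  h-injective : Injective _≡_ _≡_ h
  h-injective {i} {j} eq = inj (pred-injective {{>-nonZero (f≥1 i)}} {{>-nonZero (f≥1 j)}}
    (fromℕ<-injective _ _ (f-1<k i) (f-1<k j) eq))

Injective₂ : ∀ {r c} → Matrix r c → Set
Injective₂ A = ∀ {i j i′ j′} → A i j ≡ A i′ j′ → i ≡ i′ × j ≡ j′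

columnSums-lower : ∀ {r c} (A : Matrix r c) → (∀ i j → 1 ≤ A i j) → Injective₂ A →
                   c * r * suc (c * r) ≤ 2 * sum (columnSum A)
columnSums-lower {r} {c} A A≥1 inj = begin
  c * r * suc (c * r)          ≤⟨ sum-positive-injective f (λ k → A≥1 _ _) f-injective ⟩
  2 * sum f                    ≡⟨ cong (2 *_) (sum-combine c f) ⟩
  2 * sum (λ j → sum λ i → f (combine {c} {r} j i)) ≡⟨ cong (2 *_) (sum-cong-≗ {c} λ j → sum-cong-≗ {r} λ i →
                                     cong (λ ji → A (proj₂ ji) (proj₁ ji)) (remQuot-combine j i)) ⟩
  2 * sum (columnSum A)        ∎
  where
  open ≤-Reasoning
  f : Fin (c * r) → ℕ
  f k = A (proj₂ (remQuot {c} r k)) (proj₁ (remQuot {c} r k))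
  f-injective : Injective _≡_ _≡_ f
  f-injective {k} {l} eq =
    trans (sym (combine-remQuot {c} r k)) (trans (cong₂ combine (proj₂ (inj eq)) (proj₁ (inj eq))) (combine-remQuot {c} r l))

-- The reflection v ↦ K + 1 - v keeps the entries distinct and positive, so the lower bound applies
-- to the reflected matrix. The two totals add up to K(K + 1).
columnSums-upper : ∀ {r c} (A : Matrix r c) → (∀ i j → A i j ≤ c * r) → Injective₂ A →
                   2 * sum (columnSum A) ≤ c * r * suc (c * r)
columnSums-upper {r} {c} A A≤K inj = +-cancelʳ-≤ (2 * sum (columnSum Ā)) _ _ (begin
  2 * sum (columnSum A) + 2 * sum (columnSum Ā) ≡⟨ *-distribˡ-+ 2 (sum (columnSum A)) _ ⟨
  2 * (sum (columnSum A) + sum (columnSum Ā))   ≡⟨ cong (2 *_) A+Ā ⟩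
  2 * (c * (r * suc K))                         ≡⟨ regroup c r (suc K) ⟩
  K * suc K + K * suc K                         ≤⟨ +-monoʳ-≤ (K * suc K) (columnSums-lower Ā Ā≥1 Ā-injective) ⟩
  K * suc K + 2 * sum (columnSum Ā)             ∎)
  where
  open ≤-Reasoning
  K : ℕ
  K = c * r
  Ā : Matrix r c
  Ā i j = suc K ∸ A i j
  Ā≥1 : ∀ i j → 1 ≤ Ā i j
  Ā≥1 i j = m<n⇒0<n∸m (s≤s (A≤K i j))
  Ā-injective : Injective₂ Ā
  Ā-injective eq = inj (∸-cancelˡ-≡ (m≤n⇒m≤1+n (A≤K _ _)) (m≤n⇒m≤1+n (A≤K _ _)) eq)
  A+Ā : sum (columnSum A) + sum (columnSum Ā) ≡ c * (r * suc K)
  A+Ā = begin-equality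
    sum (columnSum A) + sum (columnSum Ā)         ≡⟨ ∑-distrib-+ (columnSum A) (columnSum Ā) ⟨
    sum (λ j → columnSum A j + columnSum Ā j)     ≡⟨ sum-cong-≗ {c} (λ j → ∑-distrib-+ (λ i → A i j) (λ i → Ā i j)) ⟨
    sum {c} (λ j → sum {r} (λ i → A i j + Ā i j)) ≡⟨ sum-cong-≗ {c} (λ j → sum-cong-≗ {r} λ i → m+[n∸m]≡n (m≤n⇒m≤1+n (A≤K i j))) ⟩
    sum {c} (λ j → sum {r} (λ i → suc K))         ≡⟨ sum-cong-≗ {c} (λ j → sum-const r (suc K)) ⟩
    sum {c} (λ j → r * suc K)                     ≡⟨ sum-const c _ ⟩
    c * (r * suc K)                               ∎
  regroup : ∀ c r k → 2 * (c * (r * k)) ≡ c * r * k + c * r * k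
  regroup = solve-∀

-- For the whole matrix the lower and upper bounds coincide and determine the total; for the lower
-- block the lower bound is used. Each total is p times a column sum, so `p` cancels.
MCR⇒constant : ∀ {m n p} .{{_ : NonZero p}} (R : MCR m n p) →
               (m + n) * suc (p * (m + n)) ≡ 4 * MCR.constant R × n * suc (p * n) ≤ 2 * MCR.constant R
MCR⇒constant {m} {n} {p} R =
    *-cancelˡ-≡ _ _ p (begin-equality
      p * ((m + n) * suc (p * (m + n))) ≡⟨ *-assoc p (m + n) _ ⟨
      p * (m + n) * suc (p * (m + n))   ≡⟨ ≤-antisym (columnSums-lower matrix entry≥1 injective)
                                                     (columnSums-upper matrix (λ i j → ≤-trans (entry≤max i j) (≤-reflexive (*-comm (m + n) p))) injective) ⟩
      2 * sum (columnSum matrix)        ≡⟨ cong (2 *_) (trans (sum-cong-≗ {p} total) (sum-const p _)) ⟩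
      2 * (p * (constant + constant))   ≡⟨ four p constant ⟩
      p * (4 * constant)                ∎)
  , *-cancelˡ-≤ p (begin
      p * (n * suc (p * n))                        ≡⟨ *-assoc p n _ ⟨
      p * n * suc (p * n)                          ≤⟨ columnSums-lower (lowerBlock m n matrix) (λ i → entry≥1 (m ↑ʳ i))
                                                        (λ eq → map₁ (↑ʳ-injective m _ _) (injective eq)) ⟩
      2 * sum (columnSum (lowerBlock m n matrix))  ≡⟨ cong (2 *_) (trans (sum-cong-≗ {p} lowerSums) (sum-const p constant)) ⟩
      2 * (p * constant)                           ≡⟨ two p constant ⟩
      p * (2 * constant)                           ∎)
  where
  open MCR R
  open ≤-Reasoning
  injective : Injective₂ matrix
  injective {i} {j} {i′} {j′} eq
    -- Two positions with equal entries both coincide with the unique position of that value.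
    with _ , _ , unique ← exactlyOnce (matrix i j) (entry≥1 i j) (entry≤max i j)
    with refl ← trans (sym (unique {i , j} refl)) (unique {i′ , j′} (sym eq)) = refl , refl
  total : ∀ j → columnSum matrix j ≡ constant + constant
  total j = trans (sum-++ m (λ i → matrix i j)) (cong₂ _+_ (upperSums j) (lowerSums j))
  four : ∀ p c → 2 * (p * (c + c)) ≡ p * (4 * c)
  four = solve-∀
  two : ∀ p c → 2 * (p * c) ≡ p * (2 * c)
  two = solve-∀

-- Completing the square: this identity and the next bring both sides of 2X² ≤ 1 + Y² to the form
-- 4p(...) + 2, where the brackets are the quantities bounded by the column sum.
2X²≡ : ∀ p n → 2 * (2 * p * n + 1) ^ 2 ≡ 4 * p * (2 * (n * suc (p * n))) + 2
2X²≡ = e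
  where
  e : ∀ p n → 2 * ((2 * p * n + 1) * ((2 * p * n + 1) * 1)) ≡ 4 * p * (2 * (n * suc (p * n))) + 2
  e = solve-∀

1+Y²≡ : ∀ p m n → 1 + (2 * p * m + 2 * p * n + 1) ^ 2 ≡ 4 * p * ((m + n) * suc (p * (m + n))) + 2
1+Y²≡ = e
  where
  e : ∀ p m n → 1 + (2 * p * m + 2 * p * n + 1) * ((2 * p * m + 2 * p * n + 1) * 1) ≡ 4 * p * ((m + n) * suc (p * (m + n))) + 2
  e = solve-∀

MCR⇒4∣m+n : ∀ A B {p} .{{_ : NonZero p}} → MCR (A * 2) (B * 2) p → 4 ∣ A * 2 + B * 2
MCR⇒4∣m+n A B {p} R = subst (4 ∣_) (*-distribʳ-+ 2 A B) (*-monoˡ-∣ 2 2∣h)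
  where
  h c : ℕ
  h = A + B
  c = MCR.constant R
  2∣h : 2 ∣ h
  -- With N = 2h, the equation N(pN + 1) = 4c halves to 2h(ph) + h = 2c, so `h` is even.
  2∣h = ∣m+n∣m⇒∣n (divides c (*-cancelˡ-≡ _ _ 2 (begin
    2 * (2 * (h * (p * h)) + h)                    ≡⟨ e₁ A B p ⟩
    (A * 2 + B * 2) * suc (p * (A * 2 + B * 2))    ≡⟨ proj₁ (MCR⇒constant R) ⟩
    4 * c                                          ≡⟨ e₂ c ⟩
    2 * (c * 2)                                    ∎))) (m∣m*n (h * (p * h)))
    where
    open ≡-Reasoning
    e₁ : ∀ a b p → 2 * (2 * ((a + b) * (p * (a + b))) + (a + b)) ≡ (a * 2 + b * 2) * suc (p * (a * 2 + b * 2))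
    e₁ = solve-∀
    e₂ : ∀ c → 4 * c ≡ 2 * (c * 2)
    e₂ = solve-∀

MCR⇒2X²≤1+Y² : ∀ m n p .{{_ : NonZero p}} → MCR m n p →
                2 * (2 * p * n + 1) ^ 2 ≤ 1 + (2 * p * m + 2 * p * n + 1) ^ 2
MCR⇒2X²≤1+Y² m n p R = begin
  2 * (2 * p * n + 1) ^ 2                      ≡⟨ 2X²≡ p n ⟩
  4 * p * (2 * (n * suc (p * n))) + 2          ≤⟨ +-monoˡ-≤ 2 (*-monoʳ-≤ (4 * p) (begin
    2 * (n * suc (p * n))                        ≤⟨ *-monoʳ-≤ 2 (proj₂ (MCR⇒constant R)) ⟩
    2 * (2 * c)                                  ≡⟨ *-assoc 2 2 c ⟨
    4 * c                                        ≡⟨ proj₁ (MCR⇒constant R) ⟨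
    (m + n) * suc (p * (m + n))                  ∎)) ⟩
  4 * p * ((m + n) * suc (p * (m + n))) + 2    ≡⟨ 1+Y²≡ p m n ⟨
  1 + (2 * p * m + 2 * p * n + 1) ^ 2          ∎
  where
  open ≤-Reasoning
  c = MCR.constant R

-- Construction

sum-toℕ : ∀ k → 2 * sum {k} toℕ + k ≡ k * k
sum-toℕ zero    = refl
sum-toℕ (suc k) = begin
  2 * sum {k} (suc ∘ toℕ) + suc k               ≡⟨ cong (λ s → 2 * s + suc k) (∑-distrib-+ {k} (λ _ → 1) toℕ) ⟩
  2 * (sum {k} (λ _ → 1) + sum {k} toℕ) + suc k ≡⟨ cong (λ s → 2 * (s + sum {k} toℕ) + suc k) (sum-const k 1) ⟩
  2 * (k * 1 + sum {k} toℕ) + suc k             ≡⟨ shuffle k (sum {k} toℕ) ⟩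
  (2 * sum {k} toℕ + k) + suc (2 * k)           ≡⟨ cong (_+ suc (2 * k)) (sum-toℕ k) ⟩
  k * k + suc (2 * k)                           ≡⟨ square k ⟩
  suc k * suc k                                 ∎
  where
  open ≡-Reasoning
  shuffle : ∀ k s → 2 * (k * 1 + s) + suc k ≡ (2 * s + k) + suc (2 * k)
  shuffle = solve-∀
  square : ∀ k → k * k + suc (2 * k) ≡ suc k * suc k
  square = solve-∀

-- Pigeonhole: a missed value could be punched out of the codomain, leaving an injection into a
-- smaller set.
injective⇒surjective : ∀ {k} {f : Fin k → Fin k} → Injective _≡_ _≡_ f → ∀ y → ∃ λ x → f x ≡ y
injective⇒surjective {suc k} {f} inj y with any? (λ x → f x ≟ y)
... | yes hit  = hit
... | no  miss = contradiction
  (injective⇒≤ {f = λ x → punchOut {i = y} {f x} (λ eq → miss (x , sym eq))} (λ {x} {x′} → inj ∘ punchOut-injective (λ eq → miss (x , sym eq)) (λ eq → miss (x′ , sym eq))))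
  1+n≰n

injective⇒permutation : ∀ {k} (f : Fin k → Fin k) → Injective _≡_ _≡_ f → Permutation′ k
injective⇒permutation f inj = permutation f (proj₁ ∘ injective⇒surjective inj)
  (λ y → proj₂ (injective⇒surjective inj y)) (λ x → inj (proj₂ (injective⇒surjective inj (f x))))

sum-injective : ∀ {k} {f : Fin k → Fin k} → Injective _≡_ _≡_ f → sum (toℕ ∘ f) ≡ sum {k} toℕ
sum-injective {f = f} inj = sym (sum-permute toℕ (injective⇒permutation f inj))

divMod-unique : ∀ {k a a′} q q′ → a < k → a′ < k → a + q * k ≡ a′ + q′ * k → a ≡ a′ × q ≡ q′
divMod-unique {k@(suc _)} {a} {a′} q q′ a<k a′<k eq = a≡a′ , *-cancelʳ-≡ q q′ k (+-cancelˡ-≡ a _ _ (trans eq (cong (_+ q′ * k) (sym a≡a′))))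
  where
  a≡a′ : a ≡ a′
  a≡a′ = begin
    a                  ≡⟨ m<n⇒m%n≡m a<k ⟨
    a % k              ≡⟨ [m+kn]%n≡m%n a q k ⟨
    (a + q * k) % k    ≡⟨ cong (_% k) eq ⟩
    (a′ + q′ * k) % k  ≡⟨ [m+kn]%n≡m%n a′ q′ k ⟩
    a′ % k             ≡⟨ m<n⇒m%n≡m a′<k ⟩
    a′                 ∎
    where open ≡-Reasoning

module Rotation (k r : ℕ) .{{_ : NonZero k}} where

  rotate : Fin k → Fin k
  rotate j = DivMod.remainder ((toℕ j + r) divMod k)

  -- For r < k this is 1 in the last `r` columns and 0 elsewhere, so it also marks where rows are to
  -- be exchanged.
  wrap : Fin k → ℕ
  wrap j = DivMod.quotient ((toℕ j + r) divMod k)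

  rotate-wrap : ∀ j → toℕ (rotate j) + wrap j * k ≡ toℕ j + r
  rotate-wrap j = sym (DivMod.property ((toℕ j + r) divMod k))

  rotate-unique : ∀ j {v} q → v < k → v + q * k ≡ toℕ j + r → toℕ (rotate j) ≡ v
  rotate-unique j q v<k eq = proj₁ (divMod-unique (wrap j) q (toℕ<n (rotate j)) v<k (trans (rotate-wrap j) (sym eq)))

  -- Eliminating the common remainder from the two division equations gives i + wrap j · k = j +
  -- wrap i · k, and uniqueness of remainders yields i = j.
  rotate-injective : Injective _≡_ _≡_ rotate
  rotate-injective {i} {j} eq = toℕ-injective (proj₁ (divMod-unique (wrap j) (wrap i) (toℕ<n i) (toℕ<n j) (+-cancelʳ-≡ r _ _ (begin
    toℕ i + wrap j * k + r                    ≡⟨ exchange (toℕ i) (wrap j * k) r ⟩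
    toℕ i + r + wrap j * k                    ≡⟨ cong (_+ wrap j * k) (rotate-wrap i) ⟨
    toℕ (rotate i) + wrap i * k + wrap j * k  ≡⟨ exchange (toℕ (rotate i)) (wrap i * k) (wrap j * k) ⟩
    toℕ (rotate i) + wrap j * k + wrap i * k  ≡⟨ cong (λ v → toℕ v + wrap j * k + wrap i * k) eq ⟩
    toℕ (rotate j) + wrap j * k + wrap i * k  ≡⟨ cong (_+ wrap i * k) (rotate-wrap j) ⟩
    toℕ j + r + wrap i * k                    ≡⟨ exchange (toℕ j) r (wrap i * k) ⟩
    toℕ j + wrap i * k + r                    ∎))))
    where
    open ≡-Reasoning
    exchange : ∀ a b c → a + b + c ≡ a + c + b
    exchange = solve-∀

  wrap≤1 : r < k → ∀ j → wrap j ≡ 0 ⊎ wrap j ≡ 1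
  wrap≤1 r<k j with wrap j in eq
  ... | 0           = inj₁ refl
  ... | 1           = inj₂ refl
  ... | suc (suc w) = contradiction (begin-strict
    toℕ j + r                    <⟨ +-mono-< (toℕ<n j) r<k ⟩
    k + k                        ≤⟨ +-monoʳ-≤ k (m≤m+n k (w * k)) ⟩
    suc (suc w) * k              ≤⟨ m≤n+m _ (toℕ (rotate j)) ⟩
    toℕ (rotate j) + suc (suc w) * k ≡⟨ cong (λ q → toℕ (rotate j) + q * k) eq ⟨
    toℕ (rotate j) + wrap j * k  ≡⟨ rotate-wrap j ⟩
    toℕ j + r                    ∎) (<-irrefl refl)
    where open ≤-Reasoning

opposite-complement : ∀ {k} (j : Fin (suc k)) → toℕ j + toℕ (opposite j) ≡ k
opposite-complement {k} j = trans (cong (toℕ j +_) (opposite-prop j)) (m+[n∸m]≡n (s≤s⁻¹ (toℕ<n j)))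

opposite-injective : ∀ {k} → Injective _≡_ _≡_ (opposite {k})
opposite-injective {x = i} {j} eq = trans (sym (opposite-involutive i)) (trans (cong opposite eq) (opposite-involutive j))

-- Positions and values are equally many, so injectivity of the filling already makes every value
-- occur.
fromInjective : ∀ {m n p} (F : Fin (m + n) → Fin p → Fin ((m + n) * p)) →
                (∀ {i j i′ j′} → F i j ≡ F i′ j′ → i ≡ i′ × j ≡ j′) → ∀ c →
                (∀ j → columnSum (upperBlock m n (λ i j → suc (toℕ (F i j)))) j ≡ c) →
                (∀ j → columnSum (lowerBlock m n (λ i j → suc (toℕ (F i j)))) j ≡ c) →
                MCR m n p
fromInjective {m} {n} {p} F F-injective c upper lower = record
  { matrix      = λ i j → suc (toℕ (F i j))
  ; entry≥1     = λ i j → s≤s z≤n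
  ; entry≤max   = λ i j → toℕ<n (F i j)
  ; exactlyOnce = once
  ; constant    = c
  ; upperSums   = upper
  ; lowerSums   = lower
  }
  where
  flat : Fin ((m + n) * p) → Fin ((m + n) * p)
  flat = uncurry F ∘ remQuot p
  flat-injective : Injective _≡_ _≡_ flat
  flat-injective {k} {l} eq = trans (sym (combine-remQuot {m + n} p k))
    (trans (uncurry (cong₂ combine) (F-injective eq)) (combine-remQuot {m + n} p l))
  once : ∀ k → 1 ≤ k → k ≤ (m + n) * p → ∃! _≡_ λ ij → suc (toℕ (uncurry F ij)) ≡ k
  once (suc k) _ k<K with l , eq ← injective⇒surjective flat-injective (fromℕ< k<K) =
    remQuot p l , cong suc toℕF≡k ,
    λ eq′ → uncurry (cong₂ _,_) (F-injective (toℕ-injective (trans toℕF≡k (sym (suc-injective eq′)))))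
    where
    toℕF≡k : toℕ (flat l) ≡ k
    toℕF≡k = trans (cong toℕ eq) (toℕ-fromℕ< k<K)

sum-affine : ∀ {k} p (f g : Fin k → ℕ) → sum (λ i → suc (p * f i + g i)) ≡ p * sum f + sum g + k
sum-affine {zero}  p f g = sym (trans (+-identityʳ _) (trans (+-identityʳ _) (*-zeroʳ p)))
sum-affine {suc k} p f g = trans (cong (suc (p * f zero + g zero) +_) (sum-affine p (f ∘ suc) (g ∘ suc)))
  (regroup p (f zero) (g zero) (sum (f ∘ suc)) (sum (g ∘ suc)) k)
  where
  regroup : ∀ p x y f g k → suc (p * x + y) + (p * f + g + k) ≡ p * (x + f) + (y + g) + suc k
  regroup = solve-∀

-- The first m rows receive the levels t, …, t + m except t + x, which goes to
-- row m.  Starting the cyclic order at t + x + 1 puts the level just above it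
-- into row 0, ready for the exchange of rows 0 and m.
module Levels (m n₁ t x : ℕ) (t≤n₁ : t ≤ n₁) (x<m : x < m) where

  private
    module Inner = Rotation (suc m) (suc x)
    module Outer = Rotation (suc m + n₁) t

    rotateFirst : Fin (suc m + n₁) → Fin (suc m + n₁)
    rotateFirst = join (suc m) n₁ ∘ Sum.map Inner.rotate id ∘ splitAt (suc m)

    join-injective : ∀ {k l} → Injective _≡_ _≡_ (join k l)
    join-injective {k} {l} {i} {j} eq =
      trans (sym (splitAt-join k l i)) (trans (cong (splitAt k) eq) (splitAt-join k l j))

    splitAt-injective : ∀ k {l} → Injective _≡_ _≡_ (splitAt k {l})
    splitAt-injective k {l} {i} {j} eq =
      trans (sym (join-splitAt k l i)) (trans (cong (join k l) eq) (join-splitAt k l j))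

    map-injective : ∀ {s s′} → Sum.map Inner.rotate (id {A = Fin n₁}) s ≡ Sum.map Inner.rotate id s′ → s ≡ s′
    map-injective {inj₁ _} {inj₁ _} eq = cong inj₁ (Inner.rotate-injective (inj₁-injective eq))
    map-injective {inj₂ _} {inj₂ _} eq = eq

    cast-injective : ∀ {k l} .(eq : k ≡ l) → Injective _≡_ _≡_ (cast eq)
    cast-injective eq {i} {j} ci≡cj = toℕ-injective (trans (sym (toℕ-cast eq i)) (trans (cong toℕ ci≡cj) (toℕ-cast eq j)))

  -- The inner rotation treats rows 0, ..., m as an initial segment. The casts are needed because
  -- `m + suc n₁` and `suc m + n₁` agree only propositionally.
  level : Fin (m + suc n₁) → Fin (m + suc n₁)
  level = cast (sym (+-suc m n₁)) ∘ Outer.rotate ∘ rotateFirst ∘ cast (+-suc m n₁)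

  level-injective : Injective _≡_ _≡_ level
  level-injective = cast-injective (+-suc m n₁) ∘ splitAt-injective (suc m) ∘ map-injective
    ∘ join-injective ∘ Outer.rotate-injective ∘ cast-injective (sym (+-suc m n₁))

  private
    level-middle : ∀ i (v : Fin (suc m)) → toℕ i ≡ toℕ v → toℕ (level i) ≡ t + toℕ (Inner.rotate v)
    level-middle i v i≡v = begin
      toℕ (level i)                                      ≡⟨ toℕ-cast (sym (+-suc m n₁)) _ ⟩
      toℕ (Outer.rotate (rotateFirst (cast (+-suc m n₁) i))) ≡⟨ cong (toℕ ∘ Outer.rotate ∘ rotateFirst) cast-i ⟩
      toℕ (Outer.rotate (rotateFirst (v ↑ˡ n₁)))         ≡⟨ cong (toℕ ∘ Outer.rotate ∘ join (suc m) n₁ ∘ Sum.map Inner.rotate id) (splitAt-↑ˡ (suc m) v n₁) ⟩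
      toℕ (Outer.rotate (Inner.rotate v ↑ˡ n₁))          ≡⟨ Outer.rotate-unique _ 0 in-range no-wrap ⟩
      t + toℕ (Inner.rotate v)                           ∎
      where
      open ≡-Reasoning
      -- Row m counts as a middle row here, although it belongs to the lower block.
      cast-i : cast (+-suc m n₁) i ≡ v ↑ˡ n₁
      cast-i = toℕ-injective (trans (toℕ-cast _ i) (trans i≡v (sym (toℕ-↑ˡ v n₁))))
      in-range : t + toℕ (Inner.rotate v) < suc m + n₁
      in-range = subst (_< suc m + n₁) (+-comm _ t) (+-mono-<-≤ (toℕ<n (Inner.rotate v)) t≤n₁)
      no-wrap : t + toℕ (Inner.rotate v) + 0 * (suc m + n₁) ≡ toℕ (Inner.rotate v ↑ˡ n₁) + t
      no-wrap = trans (+-identityʳ _) (trans (+-comm t _) (cong (_+ t) (sym (toℕ-↑ˡ (Inner.rotate v) n₁))))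

    rotate-last : toℕ (Inner.rotate (Fin.fromℕ m)) ≡ x
    -- The last index wraps exactly once: m + (x + 1) = x + (m + 1).
    rotate-last = Inner.rotate-unique (Fin.fromℕ m) 1 (m≤n⇒m≤1+n x<m) (trans (lemma x m) (cong (_+ suc x) (sym (toℕ-fromℕ m))))
      where
      lemma : ∀ x m → x + 1 * suc m ≡ m + suc x
      lemma = solve-∀

  level-m : toℕ (level (m ↑ʳ zero)) ≡ t + x
  level-m = trans (level-middle (m ↑ʳ zero) (Fin.fromℕ m) (trans (toℕ-↑ʳ m (zero {n₁})) (trans (+-identityʳ m) (sym (toℕ-fromℕ m)))))
                       (cong (t +_) rotate-last)

  level-0 : ∀ i → toℕ i ≡ 0 → toℕ (level i) ≡ suc (t + x)
  level-0 i i≡0 = trans (level-middle i zero i≡0)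
    (trans (cong (t +_) (Inner.rotate-unique zero 0 (s≤s x<m) (+-identityʳ (suc x)))) (+-suc t x))

  sum-level : sum (toℕ ∘ level) ≡ sum {m + suc n₁} toℕ
  sum-level = sum-injective level-injective

  -- Adding the level t + x of row m completes the upper levels to the full interval t, ..., t + m.
  sum-level-upper : sum (λ (i : Fin m) → toℕ (level (i ↑ˡ suc n₁))) + (t + x) ≡ suc m * t + sum {suc m} toℕ
  sum-level-upper = begin
    sum (λ i → toℕ (level (i ↑ˡ suc n₁))) + (t + x)
      ≡⟨ cong₂ _+_ (sum-cong-≗ {m} λ i → level-middle (i ↑ˡ suc n₁) (inject₁ i) (trans (toℕ-↑ˡ i (suc n₁)) (sym (toℕ-inject₁ i))))
                   (cong (t +_) (sym rotate-last)) ⟩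
    sum (λ i → t + toℕ (Inner.rotate (inject₁ i))) + (t + toℕ (Inner.rotate (Fin.fromℕ m)))
      ≡⟨ sum-init-last {m} (λ v → t + toℕ (Inner.rotate v)) ⟨
    sum (λ v → t + toℕ (Inner.rotate v))
      ≡⟨ ∑-distrib-+ {suc m} (λ _ → t) (toℕ ∘ Inner.rotate) ⟩
    sum {suc m} (λ _ → t) + sum (toℕ ∘ Inner.rotate)
      ≡⟨ cong₂ _+_ (sum-const (suc m) t) (sum-injective Inner.rotate-injective) ⟩
    suc m * t + sum {suc m} toℕ ∎
    where open ≡-Reasoning

-- The filled matrix and its column sums

module Construction (a b p₁ t x r : ℕ) (t≤n₁ : t ≤ suc (b * 2)) (x<m : x < suc a * 2)
                    (r<p : r < suc p₁) (b≡0⇒r≡0 : b ≡ 0 → r ≡ 0) where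

  private
    m n p : ℕ
    m = suc a * 2
    n = suc b * 2
    p = suc p₁
    Offset : Set
    Offset = Fin p → Fin p

  open Levels m (suc (b * 2)) t x t≤n₁ x<m
  open Rotation p r

  alternating : ∀ k → Fin (k * 2) → Offset
  alternating (suc k) zero          = id
  alternating (suc k) (suc zero)    = opposite
  alternating (suc k) (suc (suc i)) = alternating k i

  upperOffset : Fin m → Offset
  upperOffset zero          = id
  upperOffset (suc zero)    = opposite ∘ rotate
  upperOffset (suc (suc i)) = alternating a i

  -- Only for n = 2 is there no room for a rotated row; then r = 0.
  lowerOffset : ∀ b → Fin (suc b * 2) → Offset
  lowerOffset _       zero                      = id
  lowerOffset _       (suc zero)                = opposite
  lowerOffset (suc b) (suc (suc zero))          = rotate
  lowerOffset (suc b) (suc (suc (suc zero)))    = opposite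
  lowerOffset (suc b) (suc (suc (suc (suc i)))) = alternating b i

  offset : Fin (m + n) → Offset
  offset i = [ upperOffset , lowerOffset b ]′ (splitAt m i)

  alternating-injective : ∀ k i → Injective _≡_ _≡_ (alternating k i)
  alternating-injective (suc k) zero          eq = eq
  alternating-injective (suc k) (suc zero)    eq = opposite-injective eq
  alternating-injective (suc k) (suc (suc i)) eq = alternating-injective k i eq

  upperOffset-injective : ∀ i → Injective _≡_ _≡_ (upperOffset i)
  upperOffset-injective zero          eq = eq
  upperOffset-injective (suc zero)    eq = rotate-injective (opposite-injective eq)
  upperOffset-injective (suc (suc i)) eq = alternating-injective a i eq

  lowerOffset-injective : ∀ b i → Injective _≡_ _≡_ (lowerOffset b i)
  lowerOffset-injective _       zero                      eq = eq
  lowerOffset-injective _       (suc zero)                eq = opposite-injective eq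
  lowerOffset-injective (suc b) (suc (suc zero))          eq = rotate-injective eq
  lowerOffset-injective (suc b) (suc (suc (suc zero)))    eq = opposite-injective eq
  lowerOffset-injective (suc b) (suc (suc (suc (suc i)))) eq = alternating-injective b i eq

  offset-injective : ∀ i → Injective _≡_ _≡_ (offset i)
  offset-injective i with splitAt m i
  ... | inj₁ i′ = upperOffset-injective i′
  ... | inj₂ i′ = lowerOffset-injective b i′

  sum-alternating : ∀ k j → sum (λ i → toℕ (alternating k i j)) ≡ k * p₁
  sum-alternating zero    j = refl
  sum-alternating (suc k) j = trans (sym (+-assoc (toℕ j) _ _)) (cong₂ _+_ (opposite-complement j) (sum-alternating k j))

  -- Row 0 and the reversed rotated row 1 add up to p - 1 - r, plus p in the wrapped columns. The
  -- exchange of rows later removes exactly this excess.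
  sum-upperOffset : ∀ j → sum (λ i → toℕ (upperOffset i j)) + r ≡ suc a * p₁ + wrap j * p
  sum-upperOffset j = begin
    toℕ j + (o + s) + r              ≡⟨ e₁ (toℕ j) o s r ⟩
    toℕ j + r + o + s                ≡⟨ cong (λ z → z + o + s) (rotate-wrap j) ⟨
    toℕ (rotate j) + wrap j * p + o + s ≡⟨ e₂ (toℕ (rotate j)) (wrap j * p) o s ⟩
    toℕ (rotate j) + o + s + wrap j * p ≡⟨ cong₂ (λ y z → y + z + wrap j * p) (opposite-complement (rotate j)) (sum-alternating a j) ⟩
    suc a * p₁ + wrap j * p          ∎
    where
    open ≡-Reasoning
    o s : ℕ
    o = toℕ (opposite (rotate j))
    s = sum (λ i → toℕ (alternating a i j))
    e₁ : ∀ j o s r → j + (o + s) + r ≡ j + r + o + s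
    e₁ = solve-∀
    e₂ : ∀ v w o s → v + w + o + s ≡ v + o + s + w
    e₂ = solve-∀

  -- The rotated row contributes r - wrap j · p beyond the balanced pairs, the opposite of the
  -- change in the upper block. With a single pair, r = 0 and nothing wraps.
  sum-lowerOffset : ∀ b → (b ≡ 0 → r ≡ 0) → ∀ j → sum (λ i → toℕ (lowerOffset b i j)) + wrap j * p ≡ suc b * p₁ + r
  sum-lowerOffset zero r≡0 j = cong₂ _+_
    (trans (sym (+-assoc (toℕ j) _ _)) (cong (_+ 0) (opposite-complement j)))
    (trans wrap≡0 (sym (r≡0 refl)))
    where
    wrap≡0 : wrap j * p ≡ 0
    wrap≡0 = cong (_* p) (proj₂ (divMod-unique {p} (wrap j) 0 (toℕ<n (rotate j)) (toℕ<n j)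
      (trans (rotate-wrap j) (cong (toℕ j +_) (r≡0 refl)))))
  sum-lowerOffset (suc b) _ j = begin
    toℕ j + (o + (toℕ (rotate j) + (o + s))) + wrap j * p ≡⟨ e₁ (toℕ j) o (toℕ (rotate j)) s (wrap j * p) ⟩
    toℕ j + o + o + s + (toℕ (rotate j) + wrap j * p)     ≡⟨ cong (toℕ j + o + o + s +_) (rotate-wrap j) ⟩
    toℕ j + o + o + s + (toℕ j + r)                       ≡⟨ e₂ (toℕ j) o s r ⟩
    toℕ j + o + (toℕ j + o + s) + r                       ≡⟨ cong₂ (λ y z → y + (y + z) + r) (opposite-complement j) (sum-alternating b j) ⟩
    suc (suc b) * p₁ + r                                  ∎
    where
    open ≡-Reasoning
    o s : ℕ
    o = toℕ (opposite j)
    s = sum (λ i → toℕ (alternating b i j))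
    e₁ : ∀ j o v s w → j + (o + (v + (o + s))) + w ≡ j + o + o + s + (v + w)
    e₁ = solve-∀
    e₂ : ∀ j o s r → j + o + o + s + (j + r) ≡ j + o + (j + o + s) + r
    e₂ = solve-∀

  base : Fin (m + n) → Fin p → Fin ((m + n) * p)
  base i j = combine (level i) (offset i j)

  -- Applied to `wrap j`, this acts in the last `r` columns. Both exchanged rows have offset `id`
  -- and adjacent levels, so each exchange moves p from the upper block to the lower.
  exchangeRows : ℕ → Permutation′ (m + n)
  exchangeRows 0       = Perm.id
  exchangeRows (suc _) = transpose zero (m ↑ʳ zero)

  filling : Fin (m + n) → Fin p → Fin ((m + n) * p)
  filling i j = base (exchangeRows (wrap j) ⟨$⟩ʳ i) j

  -- The exchange depends on the column, so the column has to be recovered first: the level gives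
  -- the row after the exchange, its offset gives the column, and then the exchange can be undone.
  filling-injective : ∀ {i j i′ j′} → filling i j ≡ filling i′ j′ → i ≡ i′ × j ≡ j′
  filling-injective {i} {j} {i′} {j′} eq
    with lev≡ , off≡ ← combine-injective _ _ _ _ eq
    with row≡ ← level-injective {exchangeRows (wrap j) ⟨$⟩ʳ i} {exchangeRows (wrap j′) ⟨$⟩ʳ i′} lev≡
    with refl ← offset-injective (exchangeRows (wrap j) ⟨$⟩ʳ i) {j} {j′} (trans off≡ (cong (λ k → offset k j′) (sym row≡)))
    = Injection.injective (↔⇒↣ (exchangeRows (wrap j))) row≡ , refl

  private
    entry : Fin (m + n) → Fin p → ℕ
    entry i j = suc (toℕ (base i j))

    entry≡ : ∀ i j {o} → offset i ≡ o → entry i j ≡ suc (p * toℕ (level i) + toℕ (o j))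
    entry≡ i j refl = cong suc (toℕ-combine (level i) (offset i j))

    offset-upper : ∀ i → offset (i ↑ˡ n) ≡ upperOffset i
    offset-upper i = cong [ upperOffset , lowerOffset b ]′ (splitAt-↑ˡ m i n)

    offset-lower : ∀ i → offset (m ↑ʳ i) ≡ lowerOffset b i
    offset-lower i = cong [ upperOffset , lowerOffset b ]′ (splitAt-↑ʳ m n i)

    sum-base-upper : ∀ j → sum (λ (i : Fin m) → entry (i ↑ˡ n) j) ≡
      p * sum (λ (i : Fin m) → toℕ (level (i ↑ˡ n))) + sum (λ i → toℕ (upperOffset i j)) + m
    sum-base-upper j = trans (sum-cong-≗ {m} λ i → entry≡ (i ↑ˡ n) j (offset-upper i))
      (sum-affine p (λ (i : Fin m) → toℕ (level (i ↑ˡ n))) (λ i → toℕ (upperOffset i j)))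

    sum-base-lower : ∀ j → sum (λ i → entry (m ↑ʳ i) j) ≡
      p * sum (λ i → toℕ (level (m ↑ʳ i))) + sum (λ i → toℕ (lowerOffset b i j)) + n
    sum-base-lower j = trans (sum-cong-≗ {n} λ i → entry≡ (m ↑ʳ i) j (offset-lower i))
      (sum-affine p (λ (i : Fin n) → toℕ (level (m ↑ʳ i))) (λ i → toℕ (lowerOffset b i j)))

    ↑ˡ≢↑ʳ : ∀ (i : Fin m) (k : Fin n) → i ↑ˡ n ≢ m ↑ʳ k
    ↑ˡ≢↑ʳ i k eq with () ← trans (sym (splitAt-↑ˡ m i n)) (trans (cong (splitAt m) eq) (splitAt-↑ʳ m n k))

    exchangeRows-fix : ∀ (i : Fin (suc (a * 2))) → exchangeRows 1 ⟨$⟩ʳ (suc i ↑ˡ n) ≡ suc i ↑ˡ n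
    exchangeRows-fix i rewrite dec-false (suc i ↑ˡ n ≟ m ↑ʳ zero) (↑ˡ≢↑ʳ (suc i) zero) = refl

    sum-exchanged : ∀ w j → w ≡ 0 ⊎ w ≡ 1 →
      sum (λ (i : Fin m) → entry (exchangeRows w ⟨$⟩ʳ (i ↑ˡ n)) j) + w * p ≡ sum (λ (i : Fin m) → entry (i ↑ˡ n) j)
    sum-exchanged w j (inj₁ refl) = +-identityʳ _
    sum-exchanged w j (inj₂ refl) = begin
      entry (m ↑ʳ zero) j + sum (λ (i : Fin (suc (a * 2))) → entry (exchangeRows 1 ⟨$⟩ʳ (suc i ↑ˡ n)) j) + (p + 0)
        ≡⟨ cong₂ (λ e s → e + s + (p + 0))
             (trans (entry≡ (m ↑ʳ zero) j (offset-lower zero)) (cong (λ l → suc (p * l + toℕ j)) level-m))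
             (sum-cong-≗ {suc (a * 2)} λ i → cong (λ k → entry k j) (exchangeRows-fix i)) ⟩
      suc (p * (t + x) + toℕ j) + rest + (p + 0)
        ≡⟨ regroup p (t + x) (toℕ j) rest ⟩
      suc (p * suc (t + x) + toℕ j) + rest
        ≡⟨ cong (_+ rest) (trans (entry≡ zero j refl) (cong (λ l → suc (p * l + toℕ j)) (level-0 zero refl))) ⟨
      entry zero j + rest ∎
      where
      open ≡-Reasoning
      rest : ℕ
      rest = sum (λ (i : Fin (suc (a * 2))) → entry (suc i ↑ˡ n) j)
      regroup : ∀ p l j s → suc (p * l + j) + s + (p + 0) ≡ suc (p * suc l + j) + s
      regroup = solve-∀

    A : Matrix (m + n) p
    A i j = suc (toℕ (filling i j))

    halfSum-odd : sum {suc m} toℕ ≡ suc a * suc m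
    halfSum-odd = *-cancelˡ-≡ _ _ 2 (+-cancelʳ-≡ (suc m) _ _ (trans (sum-toℕ (suc m)) (e (suc a))))
      where
      e : ∀ a → suc (a * 2) * suc (a * 2) ≡ 2 * (a * suc (a * 2)) + suc (a * 2)
      e = solve-∀

    h : ℕ
    h = suc a + suc b

    halfSum-even : sum {m + n} toℕ + h ≡ h * (m + n)
    halfSum-even = *-cancelˡ-≡ _ _ 2 (trans (e₁ (sum {m + n} toℕ) (suc a) (suc b)) (trans (sum-toℕ (m + n)) (e₂ (suc a) (suc b))))
      where
      e₁ : ∀ s a b → 2 * (s + (a + b)) ≡ 2 * s + (a * 2 + b * 2)
      e₁ = solve-∀
      e₂ : ∀ a b → (a * 2 + b * 2) * (a * 2 + b * 2) ≡ 2 * ((a + b) * (a * 2 + b * 2))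
      e₂ = solve-∀

  upperSum : ∀ j → columnSum (upperBlock m n A) j + r + p * x ≡ p * (m * t) + p * (suc a * suc m) + m + suc a * p₁
  -- Adding `w * p` undoes the exchange, and p(t + x) supplies the missing level. The wrap terms
  -- then cancel, leaving a value independent of the column.
  upperSum j = +-cancelʳ-≡ (w * p + p * t) _ _ (begin
    U + r + p * x + (w * p + p * t)       ≡⟨ e₁ U r p x (w * p) t ⟩
    U + w * p + (r + p * (t + x))         ≡⟨ cong (_+ (r + p * (t + x))) (trans (sum-exchanged w j (wrap≤1 r<p j)) (sum-base-upper j)) ⟩
    p * ℓ + o + m + (r + p * (t + x))     ≡⟨ e₂ p ℓ o m r (t + x) ⟩
    p * (ℓ + (t + x)) + m + (o + r)       ≡⟨ cong₂ (λ y z → p * y + m + z) (trans sum-level-upper (cong (suc m * t +_) halfSum-odd)) (sum-upperOffset j) ⟩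
    p * (suc m * t + suc a * suc m) + m + (suc a * p₁ + w * p)  ≡⟨ e₃ p m t (suc a * suc m) (suc a * p₁) (w * p) ⟩
    p * (m * t) + p * (suc a * suc m) + m + suc a * p₁ + (w * p + p * t) ∎)
    where
    open ≡-Reasoning
    U w ℓ o : ℕ
    U = columnSum (upperBlock m n A) j
    w = wrap j
    ℓ = sum (λ (i : Fin m) → toℕ (level (i ↑ˡ n)))
    o = sum (λ i → toℕ (upperOffset i j))
    e₁ : ∀ U r p x w t → U + r + p * x + (w + p * t) ≡ U + w + (r + p * (t + x))
    e₁ = solve-∀
    e₂ : ∀ p ℓ o m r y → p * ℓ + o + m + (r + p * y) ≡ p * (ℓ + y) + m + (o + r)
    e₂ = solve-∀
    e₃ : ∀ p m t y z w → p * (suc m * t + y) + m + (z + w) ≡ p * (m * t) + p * y + m + z + (w + p * t)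
    e₃ = solve-∀

  totalSum : ∀ j → columnSum A j + p * h ≡ p * (h * (m + n)) + h * p₁ + (m + n)
  totalSum j = +-cancelʳ-≡ (r + w * p) _ _ (begin
    columnSum A j + p * h + (r + w * p)
      -- An exchange permutes the whole column, so the total can be computed from `base`; the two
      -- rotations then compensate each other.
      ≡⟨ cong (λ s → s + p * h + (r + w * p)) (trans (sym (sum-permute (λ i → entry i j) (exchangeRows w)))
           (trans (sum-++ m (λ i → entry i j)) (cong₂ _+_ (sum-base-upper j) (sum-base-lower j)))) ⟩
    p * ℓ + o + m + (p * ℓ′ + o′ + n) + p * h + (r + w * p)
      ≡⟨ e₁ p ℓ o m ℓ′ o′ n h r (w * p) ⟩
    p * (ℓ + ℓ′ + h) + (o + r) + (o′ + w * p) + (m + n)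
      ≡⟨ cong (λ s → s + (m + n)) (cong₂ _+_ (cong₂ _+_ (cong (p *_) levels) (sum-upperOffset j)) (sum-lowerOffset b b≡0⇒r≡0 j)) ⟩
    p * (h * (m + n)) + (suc a * p₁ + w * p) + (suc b * p₁ + r) + (m + n)
      ≡⟨ e₂ (p * (h * (m + n))) (suc a) (suc b) p₁ (w * p) r (m + n) ⟩
    p * (h * (m + n)) + h * p₁ + (m + n) + (r + w * p) ∎)
    where
    open ≡-Reasoning
    w ℓ ℓ′ o o′ : ℕ
    w = wrap j
    ℓ = sum (λ (i : Fin m) → toℕ (level (i ↑ˡ n)))
    ℓ′ = sum (λ i → toℕ (level (m ↑ʳ i)))
    o = sum (λ i → toℕ (upperOffset i j))
    o′ = sum (λ i → toℕ (lowerOffset b i j))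
    levels : ℓ + ℓ′ + h ≡ h * (m + n)
    levels = trans (cong (_+ h) (trans (sym (sum-++ m (toℕ ∘ level))) sum-level)) halfSum-even
    e₁ : ∀ p ℓ o m ℓ′ o′ n h r w → p * ℓ + o + m + (p * ℓ′ + o′ + n) + p * h + (r + w) ≡
                                   p * (ℓ + ℓ′ + h) + (o + r) + (o′ + w) + (m + n)
    e₁ = solve-∀
    e₂ : ∀ y a b q w r z → y + (a * q + w) + (b * q + r) + z ≡ y + (a + b) * q + z + (r + w)
    e₂ = solve-∀

  rectangle : ∀ c → c + r + p * x ≡ p * (m * t) + p * (suc a * suc m) + m + suc a * p₁ →
              c + c + p * h ≡ p * (h * (m + n)) + h * p₁ + (m + n) → MCR m n p
  rectangle c upper≡ total≡ = fromInjective filling filling-injective c upper lower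
    where
    upper : ∀ j → columnSum (upperBlock m n A) j ≡ c
    upper j = +-cancelʳ-≡ r _ _ (+-cancelʳ-≡ (p * x) _ _ (trans (upperSum j) (sym upper≡)))
    lower : ∀ j → columnSum (lowerBlock m n A) j ≡ c
    lower j = +-cancelˡ-≡ c _ _ (trans (cong (_+ _) (sym (upper j)))
      (trans (sym (sum-++ m (λ i → A i j))) (+-cancelʳ-≡ (p * h) _ _ (trans (totalSum j) (sym total≡)))))

-- Choice of the parameters

sufficient : ∀ a b p s .{{_ : NonZero p}} → suc a ≤ suc b → suc a + suc b ≡ s * 2 →
             2 * (p * (suc b * suc b)) + suc b ≤ 4 * (p * (s * s)) + s →
             MCR (suc a * 2) (suc b * 2) p
sufficient a b p@(suc p₁) s a≤b a+b≡2s low≤c =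
  Construction.rectangle a b p₁ t (toℕ x) (toℕ r) (m∸n≤m (suc (b * 2)) y) (toℕ<n x) (toℕ<n r) b≡0⇒r≡0 c upper≡ total≡
  where
  A B m h low c D : ℕ
  A = suc a
  B = suc b
  m = A * 2
  h = A + B
  -- With n = 2B and N = 4s, `low` is n(pn + 1)/2, the least possible mean column sum of the lower
  -- block, and `c` is N(pN + 1)/4.
  low = 2 * (p * (B * B)) + B
  c = 4 * (p * (s * s)) + s
  D = c ∸ low
  -- With the highest levels in the upper block its column sums would be c + D.
  module D/p = DivMod (D divMod p)
  module Q/m = DivMod (D/p.quotient divMod m)
  -- Here D = r + (x + ym)p. Lowering the whole interval of upper levels by `y` saves ymp, moving
  -- the omitted level up by `x` saves xp, and exchange with rotation saves the remaining `r`.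
  r = D/p.remainder
  x = Q/m.remainder
  y = Q/m.quotient
  t = suc (b * 2) ∸ y

  low+D≡c : low + D ≡ c
  low+D≡c = m+[n∸m]≡n low≤c

  D≡ : D ≡ toℕ r + (toℕ x + y * m) * p
  D≡ = trans D/p.property (cong (λ q → toℕ r + q * p) Q/m.property)

  c≡ : c ≡ p * (h * h) + s
  c≡ = trans (e p s) (cong (λ z → p * (z * z) + s) (sym a+b≡2s))
    where
    e : ∀ p s → 4 * (p * (s * s)) + s ≡ p * (s * 2 * (s * 2)) + s
    e = solve-∀

  s≤B : s ≤ B
  s≤B = *-cancelʳ-≤ s B 2 (begin
    s * 2  ≡⟨ a+b≡2s ⟨
    A + B  ≤⟨ +-monoˡ-≤ B a≤b ⟩
    B + B  ≡⟨ e B ⟩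
    B * 2  ∎)
    where
    open ≤-Reasoning
    e : ∀ b → b + b ≡ b * 2
    e = solve-∀

  -- This bounds D below mnp, so that y < n and the subtraction defining `t` is not truncated.
  c<low+mnp : c < low + B * 2 * m * p
  c<low+mnp = begin-strict
    c                                                 ≡⟨ c≡ ⟩
    p * (h * h) + s                                   ≡⟨ e₁ p A B s ⟩
    p * (A * A) + p * (2 * (A * B) + B * B) + s       ≤⟨ +-mono-≤ (+-monoˡ-≤ (p * (2 * (A * B) + B * B)) (*-monoʳ-≤ p (*-monoʳ-≤ A a≤b))) s≤B ⟩
    p * (A * B) + p * (2 * (A * B) + B * B) + B       <⟨ m<n+m _ {p * (A * B) + p * (B * B)} z<s ⟩
    p * (A * B) + p * (B * B) + (p * (A * B) + p * (2 * (A * B) + B * B) + B) ≡⟨ e₂ p A B ⟩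
    low + B * 2 * m * p                               ∎
    where
    open ≤-Reasoning
    e₁ : ∀ p a b s → p * ((a + b) * (a + b)) + s ≡ p * (a * a) + p * (2 * (a * b) + b * b) + s
    e₁ = solve-∀
    e₂ : ∀ p a b → p * (a * b) + p * (b * b) + (p * (a * b) + p * (2 * (a * b) + b * b) + b) ≡
                   2 * (p * (b * b)) + b + b * 2 * (a * 2) * p
    e₂ = solve-∀

  y<n : y < B * 2
  y<n = ≰⇒> λ n≤y → contradiction (begin-strict
    c                         <⟨ c<low+mnp ⟩
    low + B * 2 * m * p       ≤⟨ +-monoʳ-≤ low (begin
      B * 2 * m * p                   ≤⟨ *-monoˡ-≤ p (*-monoˡ-≤ m n≤y) ⟩
      y * m * p                       ≤⟨ *-monoˡ-≤ p (m≤n+m (y * m) (toℕ x)) ⟩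
      (toℕ x + y * m) * p             ≤⟨ m≤n+m _ (toℕ r) ⟩
      toℕ r + (toℕ x + y * m) * p     ≡⟨ D≡ ⟨
      D                               ∎) ⟩
    low + D                   ≡⟨ low+D≡c ⟩
    c                         ∎) (<-irrefl refl)
    where open ≤-Reasoning

  upper≡ : c + toℕ r + p * toℕ x ≡ p * (m * t) + p * (A * suc m) + m + A * p₁
  -- Adding `low` and pmy reassembles D on the left, which becomes c + c = 2ph² + h, a polynomial in
  -- p, a and b.
  upper≡ = +-cancelʳ-≡ (p * (m * y) + low) _ _ (begin
    c + toℕ r + p * toℕ x + (p * (m * y) + low)   ≡⟨ e₁ c (toℕ r) p (toℕ x) m y low ⟩
    c + (low + (toℕ r + (toℕ x + y * m) * p))     ≡⟨ cong (c +_) (trans (cong (low +_) (sym D≡)) low+D≡c) ⟩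
    c + c                                         ≡⟨ cong₂ _+_ c≡ c≡ ⟩
    p * (h * h) + s + (p * (h * h) + s)           ≡⟨ e₂ (p * (h * h)) s ⟩
    2 * (p * (h * h)) + s * 2                     ≡⟨ cong (λ z → 2 * (p * (h * h)) + z) a+b≡2s ⟨
    2 * (p * (h * h)) + h                         ≡⟨ e₃ p₁ a b ⟩
    p * (m * suc (b * 2)) + p * (A * suc m) + m + A * p₁ + low
      ≡⟨ cong (λ z → p * (m * z) + p * (A * suc m) + m + A * p₁ + low) (m∸n+n≡m (s≤s⁻¹ y<n)) ⟨
    p * (m * (t + y)) + p * (A * suc m) + m + A * p₁ + low  ≡⟨ e₄ p m t y (p * (A * suc m)) (A * p₁) low ⟩
    p * (m * t) + p * (A * suc m) + m + A * p₁ + (p * (m * y) + low) ∎)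
    where
    open ≡-Reasoning
    e₁ : ∀ c r p x m y l → c + r + p * x + (p * (m * y) + l) ≡ c + (l + (r + (x + y * m) * p))
    e₁ = solve-∀
    e₂ : ∀ z s → z + s + (z + s) ≡ 2 * z + s * 2
    e₂ = solve-∀
    e₃ : ∀ p a b → 2 * (suc p * ((suc a + suc b) * (suc a + suc b))) + (suc a + suc b) ≡
                   suc p * (suc a * 2 * suc (b * 2)) + suc p * (suc a * suc (suc a * 2)) + suc a * 2 + suc a * p
                     + (2 * (suc p * (suc b * suc b)) + suc b)
    e₃ = solve-∀
    e₄ : ∀ p m t y z w l → p * (m * (t + y)) + z + m + w + l ≡ p * (m * t) + z + m + w + (p * (m * y) + l)
    e₄ = solve-∀

  total≡ : c + c + p * h ≡ p * (h * (m + B * 2)) + h * p₁ + (m + B * 2)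
  total≡ = begin
    c + c + p * h                                ≡⟨ cong (_+ p * h) (cong₂ _+_ c≡ c≡) ⟩
    p * (h * h) + s + (p * (h * h) + s) + p * h  ≡⟨ e₁ (p * (h * h)) s (p * h) ⟩
    2 * (p * (h * h)) + s * 2 + p * h            ≡⟨ cong (λ z → 2 * (p * (h * h)) + z + p * h) a+b≡2s ⟨
    2 * (p * (h * h)) + h + p * h                ≡⟨ e₂ p₁ A B ⟩
    p * (h * (m + B * 2)) + h * p₁ + (m + B * 2) ∎
    where
    open ≡-Reasoning
    e₁ : ∀ z s w → z + s + (z + s) + w ≡ 2 * z + s * 2 + w
    e₁ = solve-∀
    e₂ : ∀ p a b → 2 * (suc p * ((a + b) * (a + b))) + (a + b) + suc p * (a + b) ≡
                   suc p * ((a + b) * (a * 2 + b * 2)) + (a + b) * p + (a * 2 + b * 2)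
    e₂ = solve-∀

  b≡0⇒r≡0 : b ≡ 0 → toℕ r ≡ 0
  -- For n = 2 also m = 2 and s = 1, so D = (4p + 1) - (2p + 1) = 2p, with quotient 2 and remainder
  -- 0.
  b≡0⇒r≡0 b≡0 = proj₁ (divMod-unique D/p.quotient 2 (toℕ<n r) z<s
    (trans (sym D/p.property) (+-cancelˡ-≡ low _ _ (begin
      low + D                          ≡⟨ low+D≡c ⟩
      4 * (p * (s * s)) + s            ≡⟨ cong (λ s → 4 * (p * (s * s)) + s) s≡1 ⟩
      4 * (p * 1) + 1                  ≡⟨ e p ⟩
      2 * (p * (1 * 1)) + 1 + 2 * p    ≡⟨ cong (λ b → 2 * (p * (suc b * suc b)) + suc b + 2 * p) b≡0 ⟨
      low + 2 * p                      ∎))))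
    where
    open ≡-Reasoning
    a≡0 : a ≡ 0
    a≡0 = n≤0⇒n≡0 (subst (a ≤_) b≡0 (s≤s⁻¹ a≤b))
    s≡1 : s ≡ 1
    s≡1 = *-cancelʳ-≡ s 1 2 (trans (sym a+b≡2s) (cong₂ (λ a b → suc a + suc b) a≡0 b≡0))
    e : ∀ p → 4 * (p * 1) + 1 ≡ 2 * (p * (1 * 1)) + 1 + 2 * p
    e = solve-∀

2X²≤1+Y²⇒MCR : ∀ A B p .{{_ : NonZero p}} .{{_ : NonZero (A * 2)}} → A * 2 ≤ B * 2 → 4 ∣ A * 2 + B * 2 →
                2 * (2 * p * (B * 2) + 1) ^ 2 ≤ 1 + (2 * p * (A * 2) + 2 * p * (B * 2) + 1) ^ 2 →
                MCR (A * 2) (B * 2) p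
2X²≤1+Y²⇒MCR (suc a) (suc b) p m≤n (divides s N≡4s) X≤Y =
  sufficient a b p s (*-cancelʳ-≤ A B 2 m≤n) (*-cancelʳ-≡ _ _ 2 (trans (*-distribʳ-+ 2 A B) (trans N≡4s (sym (*-assoc s 2 2)))))
    -- Substituting n = 2B and N = 4s shows the hypothesis to be 16p times the required inequality,
    -- with 2 added to both sides.
    (*-cancelˡ-≤ 4 (*-cancelˡ-≤ (4 * p) {{m*n≢0 4 p}} (+-cancelʳ-≤ 2 _ _ (begin
      4 * p * (4 * (2 * (p * (B * B)) + B)) + 2        ≡⟨ cong (λ z → 4 * p * z + 2) (e₁ p B) ⟩
      4 * p * (2 * (n * suc (p * n))) + 2              ≡⟨ 2X²≡ p n ⟨
      2 * (2 * p * n + 1) ^ 2                          ≤⟨ X≤Y ⟩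
      1 + (2 * p * m + 2 * p * n + 1) ^ 2              ≡⟨ 1+Y²≡ p m n ⟩
      4 * p * ((m + n) * suc (p * (m + n))) + 2        ≡⟨ cong (λ z → 4 * p * (z * suc (p * z)) + 2) N≡4s ⟩
      4 * p * (s * 4 * suc (p * (s * 4))) + 2          ≡⟨ cong (λ z → 4 * p * z + 2) (e₂ p s) ⟩
      4 * p * (4 * (4 * (p * (s * s)) + s)) + 2        ∎))))
  where
  open ≤-Reasoning
  A B m n : ℕ
  A = suc a
  B = suc b
  m = A * 2
  n = B * 2
  e₁ : ∀ p b → 4 * (2 * (p * (b * b)) + b) ≡ 2 * (b * 2 * suc (p * (b * 2)))
  e₁ = solve-∀
  e₂ : ∀ p s → s * 4 * suc (p * (s * 4)) ≡ 4 * (4 * (p * (s * s)) + s)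
  e₂ = solve-∀

-- The equivalence

open import Data.Integer.Base using (+_; _-_)

1≡u-v⇒u≡1+v : ∀ {u v} → + 1 ≡ + u - + v → u ≡ 1 + v
1≡u-v⇒u≡1+v {u} {v} eq = ℤ.+-injective (sym (trans (cong (ℤ._+ + v) eq) (Group.//-rightDividesˡ (AbelianGroup.group ℤ.+-0-abelianGroup) (+ v) (+ u))))

u≡1+v⇒1≡u-v : ∀ {u v} → u ≡ 1 + v → + 1 ≡ + u - + v
u≡1+v⇒1≡u-v {u} {v} refl = sym (Group.//-rightDividesʳ (AbelianGroup.group ℤ.+-0-abelianGroup) (+ v) (+ 1))

theorem8 : (m n p : ℕ) .{{_ : NonZero m}} .{{_ : NonZero n}} .{{_ : NonZero p}} →
    2 ∣ m → 2 ∣ n → m ≤ n →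
    let instance _ = m*n≢0 2 p in
    MCR m n p ⇔
    ( (m + n) % 4 ≡ 0
    × ( + 1 ≡ + (2 * (2 * p * n + 1) ^ 2) - + ((2 * p * m + 2 * p * n + 1) ^ 2)
    ⊎ fromℕ m ≥ℝ (√2 -ℚ 1ℚ) *ℕ n +ℝ (√2 -ℚ 1ℚ) /ℕ (2 * p) ) )
theorem8 m n p (divides A refl) (divides B refl) m≤n = mk⇔ to from
  where
  to : _
  to R = n∣m⇒m%n≡0 (m + n) 4 (MCR⇒4∣m+n A B R) , condition
    where
    condition : _
    -- Over the integers, strict inequality in 2X² ≤ 1 + Y² means 2X² ≤ Y², so the two cases are the
    -- two alternatives of (ii).
    condition with m≤n⇒m<n∨m≡n (MCR⇒2X²≤1+Y² m n p R)
    ... | inj₁ (s≤s 2X²≤Y²) = inj₂ (2X²≤Y²⇒m≥threshold m n p 2X²≤Y²)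
    ... | inj₂ 2X²≡1+Y²     = inj₁ (u≡1+v⇒1≡u-v 2X²≡1+Y²)
  from : _
  from (4∣ , inj₁ eq) = 2X²≤1+Y²⇒MCR A B p m≤n (m%n≡0⇒n∣m (m + n) 4 4∣) (≤-reflexive (1≡u-v⇒u≡1+v eq))
  from (4∣ , inj₂ m≥) = 2X²≤1+Y²⇒MCR A B p m≤n (m%n≡0⇒n∣m (m + n) 4 4∣) (m≤n⇒m≤1+n (m≥threshold⇒2X²≤Y² m n p m≥))
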